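{- $\mathrm{OSAFGMC}\not\le\mathrm{WMPL}$.
   Context: Trees. A tree $T$ is a subset of $\mathbb{N}^*$ (finite words over the naturals) with an element $\tau_0\in T$ (the root) such that every $\tau\in T$ has the form $\tau_0\cdot\tau'$ with $\tau'\in\mathbb{N}^*$, and whenever $\tau_0\cdot\tau\in T$ and $\tau'$ is a prefix of $\tau$, also $\tau_0\cdot\tau'\in T$. Elements of $T$ are nodes. A child of $\tau$ in $T$ is a node of $T$ of the form $\tau\cdot n$, $n\in\mathbb{N}$; a descendant of $\tau$ in $T$ is a node of $T$ of the form $\tau\cdot\tau'$, $\tau'\in\mathbb{N}^*$ (so $\tau$ is a descendant of itself). A subtree of $T$ is a subset of $T$ that is a tree (with any root). A path of $T$ is a subtree of $T$ each of whose nodes has at most one child in it. $T$ is non-blocking if every node has a child in $T$. For a finite set $AP$ of atomic propositions, a Kripke tree over $AP$ is a pair $(T,\mathrm{Lab})$ with $T$ a non-blocking tree and $\mathrm{Lab}:T\to 2^{AP}$. WMPL (weak monadic path logic). Formulas over $AP$: $\varphi ::= P_a(x)\mid x\le y\mid x\in X\mid \neg\varphi\mid\varphi\wedge\varphi\mid\exists x.\varphi\mid\exists^{\mathrm{p}}X.\varphi$, with $a\in AP$. First-order variables range over nodes of $T$, second-order variables over finite paths of $T$; $P_a(x)$ holds iff $a\in\mathrm{Lab}(x)$; $x\le y$ holds iff $y$ is a descendant of $x$; $x\in X$ is membership. The logic consists of its sentences. OSGMC (one-step fragment of the graded $\mu$-calculus). Let $\mathrm{Var}$ be a set of fixpoint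 variables. For $Z,O\subseteq\mathrm{Var}$, base formulas $\varphi_{Z,O}$ and fixpoint formulas $\vartheta_{Z,O}$ are given by $\varphi_{Z,O} ::= \bot\mid\top\mid a\mid\neg\varphi_{Z,O}\mid\varphi_{Z,O}\wedge\varphi_{Z,O}\mid\varphi_{Z,O}\vee\varphi_{Z,O}\mid\Diamond^{\ge k}\varphi_{O,\emptyset}\mid\Box^{<k}\varphi_{O,\emptyset}\mid X\mid\vartheta_{\emptyset,\emptyset}$ (with $a\in AP$, $k\in\mathbb{N}$, $X\in Z$), and $\vartheta_{Z,O} ::= \mu X.\vartheta_{Z\cup\{X\},O\cup\{X\}}\mid\nu X.\vartheta_{Z\cup\{X\},O\cup\{X\}}\mid\varphi_{Z,O}$ (with $X\in\mathrm{Var}$), where every occurrence of a variable must be positive (under an even number of negations). Sentences are the formulas of the form $\vartheta_{\emptyset,\emptyset}$. OSAFGMC is the alternation-free fragment of OSGMC: no alternation of fixpoint operators, i.e., in positive normal form no subformula $\mu X.\alpha$ has a subformula $\nu Y.\beta$ of $\alpha$ in which this $X$ occurs free, and dually with $\mu$ and $\nu$ exchanged. Given a Kripke tree $\mathcal{T}=(T,\mathrm{Lab})$ and an assignment $\chi$ of subsets of $T$ to variables, the denotation $[\![\vartheta]\!]^{\mathcal T}_{\chi}\subseteq T$ is standard: $[\![a]\!]=\{w: a\in\mathrm{Lab}(w)\}$, $[\![X]\!]_\chi=\chi(X)$, Boolean connectives as set operations, $[\![\Diamond^{\ge k}\varphi]\!]_\chi=\{w\in T: |\mathrm{post}(w)\cap[\![\varphi]\!]_\chi|\ge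 k\}$, $[\![\Box^{<k}\varphi]\!]_\chi=\{w\in T:|\mathrm{post}(w)\setminus[\![\varphi]\!]_\chi|<k\}$ with $\mathrm{post}(w)$ the set of children of $w$, $[\![\mu X.\vartheta]\!]_\chi=\bigcap\{W\subseteq T:[\![\vartheta]\!]_{\chi[X\mapsto W]}\subseteq W\}$, $[\![\nu X.\vartheta]\!]_\chi=\bigcup\{W\subseteq T: W\subseteq[\![\vartheta]\!]_{\chi[X\mapsto W]}\}$. A Kripke tree satisfies a sentence if its root belongs to the denotation of the sentence. Expressiveness. Two sentences over $AP$ are equivalent if they are satisfied by the same Kripke trees over $AP$. $L\le L'$ means that, for every finite $AP$, each $L$-sentence over $AP$ has an equivalent $L'$-sentence over $AP$; $L\not\le L'$ is its negation. -}

module Defs where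

open import Data.Bool.Base using (if_then_else_)
open import Data.Fin.Base using (Fin)
open import Data.Fin.Subset using (Subset) renaming (_∈_ to _∈ˢ_)
open import Data.List.Base using (List; _++_; _∷ʳ_)
open import Data.List.Membership.Propositional using () renaming (_∈_ to _∈ˡ_)
open import Data.Nat.Base using (ℕ; zero; suc)
open import Data.Nat.Properties using (_≟_)
open import Data.Product.Base using (∃; ∃-syntax; Σ-syntax; _×_)
open import Data.Sign.Base using (Sign; +; -; opposite)
open import Data.Unit.Base using (⊤)
open import Data.Vec.Functional using (Vector; _∷_; [])
open import Function.Bundles using (_⇔_)
open import Function.Definitions using (Injective)
open import Level using (Level; Lift; 0ℓ) renaming (suc to lsuc)
open import Relation.Binary.PropositionalEquality.Core using (_≡_; _≢_)
open import Relation.Nullary.Decidable.Core using (does)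
open import Relation.Nullary.Negation.Core using (¬_)
open import Relation.Unary using (Pred; _∈_; _⊆_; _≐_; _∩_; _∪_; ∁; ∅; U; ｛_｝)

infix  4 _≼_ _⊑_ _FreeIn_ _≤ᴸ_ _≰ᴸ_
infix  8 _≤′_ _∈′_
infix  7 ¬′_
infixr 6 _∧′_
infixr 5 _∨′_

private
  variable
    ℓ : Level
    k l n : ℕ

------------------------------------------------------------------------
-- Trees

-- Subsets of ℕ* are arbitrary predicates in Set, with no decidability
-- assumed; denotations and satisfaction, which quantify over subsets,
-- are in Set₁.

Word : Set
Word = List ℕ

_≼_ : Word → Word → Set
τ ≼ σ = ∃[ τ′ ] σ ≡ τ ++ τ′

record IsTree (T : Pred Word 0ℓ) : Set where
  field
    root          : Word
    root∈         : root ∈ T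
    rooted        : ∀ {τ} → τ ∈ T → root ≼ τ
    prefix-closed : ∀ {τ τ′} → root ++ τ ∈ T → τ′ ≼ τ → root ++ τ′ ∈ T

children : Pred Word 0ℓ → Word → Pred Word 0ℓ
children T τ σ = σ ∈ T × (∃[ i ] σ ≡ τ ∷ʳ i)

Subtree : Pred Word 0ℓ → Pred Word 0ℓ → Set
Subtree T S = S ⊆ T × IsTree S

Path : Pred Word 0ℓ → Pred Word 0ℓ → Set
Path T P = Subtree T P ×
  (∀ {τ σ σ′} → τ ∈ P → σ ∈ children P τ → σ′ ∈ children P τ → σ ≡ σ′)

Finite : Pred Word 0ℓ → Set
Finite P = ∃[ ws ] P ≐ (_∈ˡ ws)

NonBlocking : Pred Word 0ℓ → Set
NonBlocking T = ∀ {τ} → τ ∈ T → ∃ (children T τ)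

-- The atomic propositions are Fin n.  The labelling is a total function
-- on words, but only its values on T are ever used.

record KripkeTree (n : ℕ) : Set₁ where
  field
    T           : Pred Word 0ℓ
    isTree      : IsTree T
    nonBlocking : NonBlocking T
    Lab         : Word → Subset n

  open IsTree isTree public

------------------------------------------------------------------------
-- Weak monadic path logic

-- WMPL n k l: formulas with k free first-order and l free second-order
-- variables, as de Bruijn indices.

data WMPL (n : ℕ) : (k l : ℕ) → Set where
  P    : Fin n → Fin k → WMPL n k l
  _≤′_ : Fin k → Fin k → WMPL n k l
  _∈′_ : Fin k → Fin l → WMPL n k l
  ¬′_  : WMPL n k l → WMPL n k l
  _∧′_ : WMPL n k l → WMPL n k l → WMPL n k l
  ∃′   : WMPL n (suc k) l → WMPL n k l
  ∃ᵖ   : WMPL n k (suc l) → WMPL n k l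

module _ (𝒯 : KripkeTree n) where
  open KripkeTree 𝒯

  Holds : Vector Word k → Vector (Pred Word 0ℓ) l → WMPL n k l → Set₁
  Holds ρ η (P a x)  = Lift (lsuc 0ℓ) (a ∈ˢ Lab (ρ x))
  Holds ρ η (x ≤′ y) = Lift (lsuc 0ℓ) (ρ x ≼ ρ y)
  Holds ρ η (x ∈′ X) = Lift (lsuc 0ℓ) (ρ x ∈ η X)
  Holds ρ η (¬′ φ)   = ¬ Holds ρ η φ
  Holds ρ η (φ ∧′ ψ) = Holds ρ η φ × Holds ρ η ψ
  Holds ρ η (∃′ φ)   = ∃[ w ] w ∈ T × Holds (w ∷ ρ) η φ
  Holds ρ η (∃ᵖ φ)   = ∃[ W ] (Path T W × Finite W) × Holds ρ (W ∷ η) φ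

------------------------------------------------------------------------
-- Graded μ-calculus

Var : Set
Var = ℕ

data Fixpoint : Set where
  μ ν : Fixpoint

dual : Fixpoint → Fixpoint
dual μ = ν
dual ν = μ

data Formula (n : ℕ) : Set where
  ⊥′ ⊤′     : Formula n
  atom      : Fin n → Formula n
  ¬′_       : Formula n → Formula n
  _∧′_ _∨′_ : Formula n → Formula n → Formula n
  ◇≥ □<     : ℕ → Formula n → Formula n
  var       : Var → Formula n
  fix       : Fixpoint → Var → Formula n → Formula n

private
  variable
    B   : Pred Var 0ℓ
    X Y : Var
    κ   : Fixpoint
    φ ψ : Formula n

Assignment : Set₁
Assignment = Var → Pred Word 0ℓ

_[_↦_] : Assignment → Var → Pred Word 0ℓ → Assignment
(χ [ X ↦ W ]) Y = if does (X ≟ Y) then W else χ Y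

AtLeast : ℕ → Pred Word ℓ → Set ℓ
AtLeast k S = Σ[ f ∈ (Fin k → Word) ] Injective _≡_ _≡_ f × (∀ i → f i ∈ S)

LessThan : ℕ → Pred Word ℓ → Set ℓ
LessThan k S = ¬ AtLeast k S

module _ (𝒯 : KripkeTree n) where
  open KripkeTree 𝒯

  ⟦_⟧ : Formula n → Assignment → Pred Word (lsuc 0ℓ)
  ⟦ ⊥′ ⟧        χ w = Lift _ (w ∈ ∅)
  ⟦ ⊤′ ⟧        χ w = Lift _ (w ∈ T)
  ⟦ atom a ⟧    χ w = Lift _ (w ∈ T × a ∈ˢ Lab w)
  ⟦ ¬′ φ ⟧      χ   = T ∩ ∁ (⟦ φ ⟧ χ)
  ⟦ φ ∧′ ψ ⟧    χ   = ⟦ φ ⟧ χ ∩ ⟦ ψ ⟧ χ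
  ⟦ φ ∨′ ψ ⟧    χ   = ⟦ φ ⟧ χ ∪ ⟦ ψ ⟧ χ
  ⟦ ◇≥ k φ ⟧    χ w = w ∈ T × AtLeast k (children T w ∩ ⟦ φ ⟧ χ)
  ⟦ □< k φ ⟧    χ w = w ∈ T × LessThan k (children T w ∩ ∁ (⟦ φ ⟧ χ))
  ⟦ var X ⟧     χ w = Lift _ (w ∈ χ X)
  ⟦ fix μ X φ ⟧ χ w = ∀ W → W ⊆ T → ⟦ φ ⟧ (χ [ X ↦ W ]) ⊆ W → w ∈ W
  ⟦ fix ν X φ ⟧ χ w = ∃[ W ] W ⊆ T × W ⊆ ⟦ φ ⟧ (χ [ X ↦ W ]) × w ∈ W

------------------------------------------------------------------------
-- Subformulas, positivity, alternation

-- Sub B β φ: β has an occurrence in φ that lies in the scope of no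
-- fixpoint operator of φ binding a variable outside B.

data Sub {n} (B : Pred Var 0ℓ) (β : Formula n) : Formula n → Set where
  here : Sub B β β
  neg  : Sub B β φ → Sub B β (¬′ φ)
  ∧ˡ   : Sub B β φ → Sub B β (φ ∧′ ψ)
  ∧ʳ   : Sub B β ψ → Sub B β (φ ∧′ ψ)
  ∨ˡ   : Sub B β φ → Sub B β (φ ∨′ ψ)
  ∨ʳ   : Sub B β ψ → Sub B β (φ ∨′ ψ)
  dia  : Sub B β φ → Sub B β (◇≥ k φ)
  box  : Sub B β φ → Sub B β (□< k φ)
  fix  : Y ∈ B → Sub B β φ → Sub B β (fix κ Y φ)

_⊑_ : Formula n → Formula n → Set
β ⊑ φ = Sub U β φ

_FreeIn_ : Var → Formula n → Set
X FreeIn φ = Sub (X ≢_) (var X) φ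

-- All free occurrences of X in φ are under an even (s = +) or odd
-- (s = -) number of negations.

Signed : Sign → Var → Formula n → Set
Signed s X ⊥′          = ⊤
Signed s X ⊤′          = ⊤
Signed s X (atom a)    = ⊤
Signed s X (¬′ φ)      = Signed (opposite s) X φ
Signed s X (φ ∧′ ψ)    = Signed s X φ × Signed s X ψ
Signed s X (φ ∨′ ψ)    = Signed s X φ × Signed s X ψ
Signed s X (◇≥ k φ)    = Signed s X φ
Signed s X (□< k φ)    = Signed s X φ
Signed s X (var Y)     = X ≡ Y → s ≡ +
Signed s X (fix κ Y φ) = X ≢ Y → Signed s X φ

-- Negations are counted from the operator binding the variable, so that
-- the negation of a sentence is again a sentence.

Positive : Formula n → Set
Positive φ = ∀ {κ X α} → fix κ X α ⊑ φ → Signed + X α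

-- pnf + φ and pnf - φ are the positive normal forms of φ and of ¬′ φ.
-- A variable is unchanged by pnf - since, by positivity, its binder has
-- been dualised as well: ¬ μX.α(X) becomes νX.¬ α(¬ X).

pnf : Sign → Formula n → Formula n
pnf + ⊥′          = ⊥′
pnf - ⊥′          = ⊤′
pnf + ⊤′          = ⊤′
pnf - ⊤′          = ⊥′
pnf + (atom a)    = atom a
pnf - (atom a)    = ¬′ atom a
pnf s (¬′ φ)      = pnf (opposite s) φ
pnf + (φ ∧′ ψ)    = pnf + φ ∧′ pnf + ψ
pnf - (φ ∧′ ψ)    = pnf - φ ∨′ pnf - ψ
pnf + (φ ∨′ ψ)    = pnf + φ ∨′ pnf + ψ
pnf - (φ ∨′ ψ)    = pnf - φ ∧′ pnf - ψ
pnf + (◇≥ k φ)    = ◇≥ k (pnf + φ)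
pnf - (◇≥ k φ)    = □< k (pnf - φ)
pnf + (□< k φ)    = □< k (pnf + φ)
pnf - (□< k φ)    = ◇≥ k (pnf - φ)
pnf s (var X)     = var X
pnf + (fix κ X φ) = fix κ X (pnf + φ)
pnf - (fix κ X φ) = fix (dual κ) X (pnf - φ)

-- Sub (X ≢_) restricts to subformulas of α in which a free X is bound by
-- the outer fixpoint and not by another one in between.

AlternationFree : Formula n → Set
AlternationFree φ = ∀ {κ X α Y β} →
  fix κ X α ⊑ pnf + φ →
  Sub (X ≢_) (fix (dual κ) Y β) α →
  ¬ (X FreeIn fix (dual κ) Y β)

------------------------------------------------------------------------
-- The one-step fragment

mutual

  data Base {n} (Z O : Pred Var 0ℓ) : Formula n → Set where
    ⊥′   : Base Z O ⊥′
    ⊤′   : Base Z O ⊤′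
    atom : ∀ a → Base Z O (atom a)
    ¬′_  : Base Z O φ → Base Z O (¬′ φ)
    _∧′_ : Base Z O φ → Base Z O ψ → Base Z O (φ ∧′ ψ)
    _∨′_ : Base Z O φ → Base Z O ψ → Base Z O (φ ∨′ ψ)
    ◇≥   : ∀ k → Base O ∅ φ → Base Z O (◇≥ k φ)
    □<   : ∀ k → Base O ∅ φ → Base Z O (□< k φ)
    var  : X ∈ Z → Base Z O (var X)
    sent : Fix ∅ ∅ φ → Base Z O φ

  data Fix {n} (Z O : Pred Var 0ℓ) : Formula n → Set where
    fix  : ∀ κ X → Fix (Z ∪ ｛ X ｝) (O ∪ ｛ X ｝) φ → Fix Z O (fix κ X φ)
    base : Base Z O φ → Fix Z O φ

record OSGMCSentence (n : ℕ) : Set where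
  field
    formula  : Formula n
    oneStep  : Fix ∅ ∅ formula
    positive : Positive formula

record OSAFGMCSentence (n : ℕ) : Set where
  field
    sentence        : OSGMCSentence n
    alternationFree : AlternationFree (OSGMCSentence.formula sentence)

  open OSGMCSentence sentence public

------------------------------------------------------------------------
-- Expressiveness

record Logic : Set₂ where
  field
    Sentence : ℕ → Set
    _⊨_      : KripkeTree n → Sentence n → Set₁

_≤ᴸ_ : Logic → Logic → Set₁
L ≤ᴸ L′ = ∀ n (φ : Sentence L n) →
  Σ[ ψ ∈ Sentence L′ n ] (∀ 𝒯 → _⊨_ L 𝒯 φ ⇔ _⊨_ L′ 𝒯 ψ)
  where open Logic

_≰ᴸ_ : Logic → Logic → Set₁
L ≰ᴸ L′ = ¬ (L ≤ᴸ L′)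

wmpl : Logic
wmpl = record
  { Sentence = λ n → WMPL n 0 0
  ; _⊨_      = λ 𝒯 φ → Holds 𝒯 [] [] φ
  }

-- A sentence has no free variables, so the choice of assignment is
-- immaterial.

osafgmc : Logic
osafgmc = record
  { Sentence = OSAFGMCSentence
  ; _⊨_      = λ 𝒯 φ →
      KripkeTree.root 𝒯 ∈ ⟦ 𝒯 ⟧ (OSAFGMCSentence.formula φ) (λ _ → ∅)
  }

{-# OPTIONS --safe #-}

-- The separating sentence is μX. a ∨ □X: every path eventually meets a.
-- Consider trees whose nodes carry a state, which is either a pair (m , d),
-- where the states of children decrease lexicographically until m = 0
-- (labelled a), or inf, which may be followed by any state.  Every state
-- occurs infinitely often among the children that may carry it.  The
-- sentence holds below each pair and fails below inf.  On the other hand,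
-- a node (m , d) with m > k can imitate inf for k rounds of an
-- Ehrenfeucht–Fraïssé game: as long as a branch stays on levels ≥ k it is
-- answered on level k, by as many nodes as it has, and once it drops below
-- k it is copied.  A finite path is determined by its two endpoints, so a
-- path quantifier costs two rounds.

module Submission where

open import Data.Empty using (⊥; ⊥-elim)
open import Data.Fin.Base using (zero; suc)
open import Data.Fin.Subset using (Subset; inside; outside) renaming (_∈_ to _∈ˢ_)
open import Data.List.Base using (List; []; _∷_; _++_; _∷ʳ_; length; map)
import Data.List.Extrema.Nat as Ext
open import Data.List.Membership.DecPropositional using () renaming (_∈?_ to mem?)
open import Data.List.Membership.Propositional using (_∉_) renaming (_∈_ to _∈ˡ_)
open import Data.List.Membership.Propositional.Properties using (∈-map⁺; ∈-map⁻)
open import Data.List.Properties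
  using (++-assoc; ++-identityʳ; length-++;
         ∷-injective; ∷-injectiveˡ; ∷-injectiveʳ; ∷ʳ-injectiveʳ)
open import Data.List.Relation.Unary.All as All using ()
open import Data.List.Relation.Unary.All.Properties using (map⁺)
open import Data.List.Relation.Unary.Any using (here; there)
open import Data.Nat.Base using (ℕ; zero; suc; _+_; _≤_; _<_; s≤s; _⊔_)
open import Data.Nat.Induction using (<-rec)
open import Data.Nat.Properties
  using (_≟_; _<?_; ≮⇒≥; ≤-refl; ≤-trans; n<1+n; 1+n≰n; <⇒≤;
         +-suc; suc-injective; +-identityʳ; +-cancelˡ-≤; m⊔n≤o⇒m≤o; m⊔n≤o⇒n≤o)
open import Data.Product.Base using (∃-syntax; Σ-syntax; _×_; _,_; proj₁; proj₂)
open import Data.Sum.Base using (inj₁; inj₂)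
open import Data.Unit.Base using (tt)
open import Data.Vec.Base as Vec using ()
open import Function.Base using (_∘_)
open import Function.Bundles using (module Equivalence)
open import Level using (lift; 0ℓ)
open import Relation.Binary.PropositionalEquality.Core using (_≡_; refl; sym; trans; cong; subst; subst₂)
open import Relation.Nullary.Decidable.Core using (yes; no)
open import Relation.Nullary.Negation.Core using (¬_; contradiction)
open import Relation.Unary using (Pred; _∈_; _⊆_; _≐_)

open import Defs

private
  variable
    k l m n q : ℕ
    i i′ j j′ a b c d : ℕ
    u v w w′ x y r e r′ e′ : Word
    xs xs′ ys ys′ : List ℕ

-- The prefix order and finite paths

≼-refl : w ≼ w
≼-refl = [] , sym (++-identityʳ _)

≼-trans : u ≼ v → v ≼ w → u ≼ w
≼-trans {u} (t , refl) (t′ , refl) = t ++ t′ , ++-assoc u t t′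

≼-∷ : u ≼ v → (i ∷ u) ≼ (i ∷ v)
≼-∷ (t , refl) = t , refl

≼-∷⁻ : (i ∷ u) ≼ (j ∷ v) → i ≡ j × u ≼ v
≼-∷⁻ (t , eq) with refl , eq′ ← ∷-injective eq = refl , t , eq′

++-monoʳ-≼ : ∀ u → v ≼ w → (u ++ v) ≼ (u ++ w)
++-monoʳ-≼ []      p = p
++-monoʳ-≼ (i ∷ u) p = ≼-∷ (++-monoʳ-≼ u p)

++-cancelˡ-≼ : ∀ u → (u ++ v) ≼ (u ++ w) → v ≼ w
++-cancelˡ-≼ []      p = p
++-cancelˡ-≼ (i ∷ u) p = ++-cancelˡ-≼ u (proj₂ (≼-∷⁻ p))

∷ʳ-≼-unique : ∀ u → (u ∷ʳ i) ≼ e → (u ∷ʳ j) ≼ e → i ≡ j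
∷ʳ-≼-unique []      (t , refl) (t′ , eq) = ∷-injectiveˡ eq
∷ʳ-≼-unique (k ∷ u) (t , refl) (t′ , eq) = ∷ʳ-≼-unique u (t , refl) (t′ , ∷-injectiveʳ eq)

Interval : Word → Word → Pred Word 0ℓ
Interval r e w = r ≼ w × w ≼ e

prefixes : Word → List Word
prefixes []      = [] ∷ []
prefixes (i ∷ w) = [] ∷ map (i ∷_) (prefixes w)

≼⇒∈prefixes : u ≼ w → u ∈ˡ prefixes w
≼⇒∈prefixes {[]}    {[]}    p = here refl
≼⇒∈prefixes {[]}    {_ ∷ _} p = here refl
≼⇒∈prefixes {_ ∷ _} {[]}    (_ , ())
≼⇒∈prefixes {_ ∷ _} {_ ∷ _} p with refl , p′ ← ≼-∷⁻ p = there (∈-map⁺ _ (≼⇒∈prefixes p′))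

All-prefixes : ∀ w → All.All (_≼ w) (prefixes w)
All-prefixes []      = ≼-refl All.∷ All.[]
All-prefixes (i ∷ w) = (_ , refl) All.∷ map⁺ (All.map ≼-∷ (All-prefixes w))

Interval-path : ∀ {T} → (∀ {w} → w ≼ e → w ∈ T) → r ≼ e → Path T (Interval r e)
Interval-path {e} {r} ⊆T r≼e = ((⊆T ∘ proj₂) , tree) , unique
  where
  tree : IsTree (Interval r e)
  tree = record
    { root          = r
    ; root∈         = ≼-refl , r≼e
    ; rooted        = proj₁
    ; prefix-closed = λ (_ , p) q → (_ , refl) , ≼-trans (++-monoʳ-≼ r q) p
    }
  unique : ∀ {τ σ σ′} → τ ∈ Interval r e → σ ∈ children (Interval r e) τ →
           σ′ ∈ children (Interval r e) τ → σ ≡ σ′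
  unique {τ} _ ((_ , p) , i , refl) ((_ , p′) , i′ , refl) =
    cong (τ ∷ʳ_) (∷ʳ-≼-unique τ p p′)

Interval-finite : r ≼ e → Finite (Interval r e)
Interval-finite {r} (t , refl) = map (r ++_) (prefixes t) , to , from
  where
  to : Interval r (r ++ t) ⊆ (_∈ˡ map (r ++_) (prefixes t))
  to ((_ , refl) , p) = ∈-map⁺ _ (≼⇒∈prefixes (++-cancelˡ-≼ r p))
  from : (_∈ˡ map (r ++_) (prefixes t)) ⊆ Interval r (r ++ t)
  from w∈ with u , u∈ , refl ← ∈-map⁻ (r ++_) w∈ =
    (u , refl) , ++-monoʳ-≼ r (All.lookup (All-prefixes t) u∈)

-- The far end of a finite path is its longest node.
finitePath⇒Interval : ∀ {T W} → Path T W → Finite W →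
  ∃[ r ] ∃[ e ] r ∈ T × e ∈ T × r ≼ e × W ≐ Interval r e
finitePath⇒Interval {T} {W} ((W⊆T , tree) , unique) (ws , W⊆ws , ws⊆W) =
  root , tip , W⊆T root∈ , W⊆T tip∈W , rooted tip∈W , to , λ (p , q) → closed tip∈W p q
  where
  open IsTree tree
  tip : Word
  tip = Ext.argmax length root ws
  tip∈W : tip ∈ W
  tip∈W = Ext.argmax-all length root∈ (All.tabulate ws⊆W)
  longest : ∀ {w} → w ∈ W → length w ≤ length tip
  longest w∈ = All.lookup (Ext.f[xs]≤f[argmax] root ws) (W⊆ws w∈)
  closed : v ∈ W → root ≼ u → u ≼ v → u ∈ W
  closed v∈ (_ , refl) (t , refl) = prefix-closed (subst (_∈ W) (++-assoc root _ t) v∈) (t , refl)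
  -- `p` is the common part read so far. The next letters of both words lead to children of `p` in
  -- the path, so they agree.
  linear : ∀ p u v → root ≼ p → p ++ u ∈ W → p ++ v ∈ W → length u ≤ length v → u ≼ v
  linear p []      v       _  _   _   _       = v , refl
  linear p (i ∷ u) (j ∷ v) rp u∈W v∈W (s≤s h) =
    subst (λ z → (i ∷ u) ≼ (z ∷ v)) i≡j
      (≼-∷ (linear (p ∷ʳ i) u v (≼-trans rp (_ , refl))
        (subst (_∈ W) (sym (++-assoc p _ u)) u∈W)
        (subst (λ z → (p ∷ʳ z) ++ v ∈ W) (sym i≡j) (subst (_∈ W) (sym (++-assoc p _ v)) v∈W))
        h))
    where
    child : ∀ h t → p ++ h ∷ t ∈ W → p ∷ʳ h ∈ children W p
    child h t z = closed z (≼-trans rp (_ , refl)) (t , sym (++-assoc p _ t)) , h , refl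
    i≡j : i ≡ j
    i≡j = ∷ʳ-injectiveʳ p p (unique (closed u∈W rp (_ , refl)) (child i u u∈W) (child j v v∈W))
  to : W ⊆ Interval root tip
  to {w} w∈ with rooted w∈ | rooted tip∈W | longest w∈
  ... | u , refl | v , eq | h = (u , refl) , subst (λ z → (root ++ u) ≼ z) (sym eq)
    (++-monoʳ-≼ root (linear root u v ≼-refl w∈ (subst (_∈ W) eq tip∈W)
      (+-cancelˡ-≤ (length root) _ _ (subst₂ _≤_ (length-++ root) (trans (cong length eq) (length-++ root)) h))))

-- The trees

data State : Set where
  inf  : State
  rank : ℕ → ℕ → State

private
  variable
    s s′ t t′ : State

-- `loop` keeps the tree non-blocking at `rank 0 0`, where neither `drop` nor `stay` applies.
data _⇒_ : State → State → Set where
  any  : inf ⇒ t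
  drop : c < a → rank a b ⇒ rank c d
  stay : d < b → rank a b ⇒ rank a d
  loop : rank a b ⇒ rank 0 d

-- Iterating `next` from the origin runs through the pairs antidiagonal by antidiagonal.
next : ℕ × ℕ → ℕ × ℕ
next (x , zero)  = 0 , suc x
next (x , suc y) = suc x , y

unpair : ℕ → ℕ × ℕ
unpair zero    = 0 , 0
unpair (suc i) = next (unpair i)

unpair-surjective : ∀ x y → ∃[ i ] unpair i ≡ (x , y)
unpair-surjective x y = go (x + y) x y refl
  where
  -- Induction on the antidiagonal `s` and, within it, on `x`. The pair `(0 , suc y)` comes right
  -- after `(y , 0)`, the last one of the previous antidiagonal.
  go : ∀ s x y → x + y ≡ s → ∃[ i ] unpair i ≡ (x , y)
  go s       zero    zero    _    = 0 , refl
  go s       (suc x) y       p with i , eq ← go s x (suc y) (trans (+-suc x y) p) = suc i , cong next eq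
  go (suc s) zero    (suc y) p
    with i , eq ← go s y 0 (trans (+-identityʳ y) (suc-injective p)) = suc i , cong next eq

toState : ℕ × ℕ → State
toState (zero  , _) = inf
toState (suc a , b) = rank a b

toState-surjective : ∀ t → ∃[ j ] toState (unpair j) ≡ t
toState-surjective inf        = 0 , refl
toState-surjective (rank a b) with j , eq ← unpair-surjective (suc a) b = j , cong toState eq

-- A letter determines the state it leads to and a copy number, so that
-- every state has infinitely many letters.
opaque
  decode : ℕ → State
  decode i = toState (unpair (proj₁ (unpair i)))

  copy : ℕ → ℕ
  copy i = proj₂ (unpair i)

  letter : ∀ t c → ∃[ i ] decode i ≡ t × copy i ≡ c
  letter t c
    with j , eq ← toState-surjective t
    with i , eq′ ← unpair-surjective j c
    = i , trans (cong (toState ∘ unpair ∘ proj₁) eq′) eq , cong proj₂ eq′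

-- A copy number larger than those of all letters in `xs` excludes membership. Answers in the game
-- can thus always use a new sibling.
fresh : ∀ t xs → ∃[ i ] decode i ≡ t × i ∉ xs
fresh t xs with i , eq , eq′ ← letter t (suc (Ext.max 0 (map copy xs))) =
  i , eq , λ i∈ → 1+n≰n (subst (_≤ Ext.max 0 (map copy xs)) eq′
    (All.lookup (Ext.xs≤max 0 (map copy xs)) (∈-map⁺ copy i∈)))

data Valid : State → Pred Word 0ℓ where
  []  : Valid s []
  _∷_ : s ⇒ decode i → Valid (decode i) w → Valid s (i ∷ w)

final : State → Word → State
final s []      = s
final s (i ∷ w) = final (decode i) w

final-∷ʳ : ∀ s w → final s (w ∷ʳ i) ≡ decode i
final-∷ʳ s []      = refl
final-∷ʳ s (j ∷ w) = final-∷ʳ (decode j) w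

Valid-∷ʳ : Valid s w → final s w ⇒ decode i → Valid s (w ∷ʳ i)
Valid-∷ʳ []      r = r ∷ []
Valid-∷ʳ (p ∷ v) r = p ∷ Valid-∷ʳ v r

Valid-∷ʳ⁻ : ∀ w → Valid s (w ∷ʳ i) → final s w ⇒ decode i
Valid-∷ʳ⁻ []      (r ∷ _) = r
Valid-∷ʳ⁻ (j ∷ w) (_ ∷ v) = Valid-∷ʳ⁻ w v

Valid-≼ : u ≼ w → Valid s w → Valid s u
Valid-≼ {[]}    _          _       = []
Valid-≼ {_ ∷ _} (t , refl) (r ∷ v) = r ∷ Valid-≼ (t , refl) v

successor : ∀ s → ∃[ t ] s ⇒ t
successor inf        = inf , any
successor (rank a b) = rank 0 0 , loop

label : State → Subset 1
label (rank zero _) = inside Vec.∷ Vec.[]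
label _             = outside Vec.∷ Vec.[]

𝒯 : State → KripkeTree 1
𝒯 s = record
  { T           = Valid s
  ; isTree      = record
    { root          = []
    ; root∈         = []
    ; rooted        = λ _ → _ , refl
    ; prefix-closed = λ v p → Valid-≼ p v
    }
  ; nonBlocking = nonBlocking
  ; Lab         = label ∘ final s
  }
  where
  nonBlocking : NonBlocking (Valid s)
  nonBlocking {w} v
    with t , r ← successor (final s w)
    with i , eq , _ ← letter t 0
    = w ∷ʳ i , Valid-∷ʳ v (subst (final s w ⇒_) (sym eq) r) , i , refl

-- Similar states and the simulation of a branch

data Above (k : ℕ) : State → Set where
  inf  : Above k inf
  rank : k < a → Above k (rank a b)

-- What `k` rounds cannot tell apart: all states strictly above level `k`, including `inf`, are
-- identified, and every other state only with itself.
data _~⟨_⟩_ : State → ℕ → State → Set where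
  same : s ~⟨ k ⟩ s
  both : Above k s → Above k t → s ~⟨ k ⟩ t

~-sym : s ~⟨ k ⟩ t → t ~⟨ k ⟩ s
~-sym same       = same
~-sym (both p q) = both q p

Above-pred : Above (suc k) s → Above k s
Above-pred inf      = inf
Above-pred (rank h) = rank (<⇒≤ h)

~-pred : s ~⟨ suc k ⟩ t → s ~⟨ k ⟩ t
~-pred same       = same
~-pred (both p q) = both (Above-pred p) (Above-pred q)

-- Level 0 is never strictly above `k`, so even for `k` equal to 0 a labelled state is similar only
-- to itself.
label-cong : s ~⟨ k ⟩ t → label s ≡ label t
label-cong same                              = refl
label-cong (both inf            inf)            = refl
label-cong (both inf            (rank (s≤s _))) = refl
label-cong (both (rank (s≤s _)) inf)            = refl
label-cong (both (rank (s≤s _)) (rank (s≤s _))) = refl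

-- s′ can answer any branch of length m from s with a branch of the same
-- length through similar states.
data Follows (k m : ℕ) (s s′ : State) : Set where
  same  : s ≡ s′ → Follows k m s s′
  ready : (∀ {c d} → c ≤ k → s′ ⇒ rank c d) → (∀ {d} → d < m → s′ ⇒ rank (suc k) d) →
          Follows k m s s′

-- If `s′` is strictly above level `suc k`, it can drop to level `suc k` with any second component,
-- so there is room for a branch of any length `m`. This is where a round costs one level.
~⇒Follows : s ~⟨ suc k ⟩ s′ → Follows k m s s′
~⇒Follows same              = same refl
~⇒Follows (both _ inf)      = ready (λ _ → any) (λ _ → any)
~⇒Follows (both _ (rank h)) = ready (λ c≤k → drop (≤-trans (s≤s c≤k) (<⇒≤ h))) (λ _ → drop h)

-- While the branch stays above level `k`, the answer stays on level `suc k`, its second component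
-- counting the letters still to come. Once the branch reaches a level at most `k`, the answer
-- enters the same state and copies from then on.
Follows-step : Follows k (suc m) s s′ → s ⇒ t →
  ∃[ t′ ] s′ ⇒ t′ × t ~⟨ k ⟩ t′ × Follows k m t t′
Follows-step (same refl) r = _ , r , same , same refl
Follows-step {k} {m} {t = inf} (ready low high) r =
  rank (suc k) m , high ≤-refl , both inf (rank ≤-refl) , ready (λ h → drop (s≤s h)) stay
Follows-step {k} {m} {t = rank a b} (ready low high) r with k <? a
... | yes k<a = rank (suc k) m , high ≤-refl , both (rank k<a) (rank ≤-refl) , ready (λ h → drop (s≤s h)) stay
... | no  k≮a = rank a b , low (≮⇒≥ k≮a) , same , same refl

-- Positions of the game

-- A pair of isomorphic finite subtrees below s and s′, with pointwise
-- similar states; the last two indices list the letters at the two roots.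
data Forest (k : ℕ) : (s s′ : State) (xs xs′ : List ℕ) → Set where
  []   : Forest k s s′ [] []
  node : i ∉ xs → i′ ∉ xs′ → s ⇒ decode i → s′ ⇒ decode i′ → decode i ~⟨ k ⟩ decode i′ →
         Forest k (decode i) (decode i′) ys ys′ → Forest k s s′ xs xs′ →
         Forest k s s′ (i ∷ xs) (i′ ∷ xs′)

-- `skip` asks for nonempty words, so the pair of empty words is matched by `root` alone.
data Match {k} : Forest k s s′ xs xs′ → Word → Word → Set where
  root : {f : Forest k s s′ xs xs′} → Match f [] []
  down : ∀ {p p′ r r′ h} {g : Forest k (decode i) (decode i′) ys ys′} {f : Forest k s s′ xs xs′} →
         Match g w w′ → Match (node {i = i} {i′ = i′} p p′ r r′ h g f) (i ∷ w) (i′ ∷ w′)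
  skip : ∀ {p p′ r r′ h} {g : Forest k (decode i) (decode i′) ys ys′} {f : Forest k s s′ xs xs′} →
         Match f (j ∷ w) (j′ ∷ w′) → Match (node {i = i} {i′ = i′} p p′ r r′ h g f) (j ∷ w) (j′ ∷ w′)

flip : Forest k s s′ xs xs′ → Forest k s′ s xs′ xs
flip []                      = []
flip (node p p′ r r′ h g f) = node p′ p r′ r (~-sym h) (flip g) (flip f)

flip-Match : {f : Forest k s s′ xs xs′} → Match f w w′ → Match (flip f) w′ w
flip-Match root     = root
flip-Match (down m) = down (flip-Match m)
flip-Match (skip m) = skip (flip-Match m)

pred : Forest (suc k) s s′ xs xs′ → Forest k s s′ xs xs′
pred []                      = []
pred (node p p′ r r′ h g f) = node p p′ r r′ (~-pred h) (pred g) (pred f)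

pred-Match : {f : Forest (suc k) s s′ xs xs′} → Match f w w′ → Match (pred f) w w′
pred-Match root     = root
pred-Match (down m) = down (pred-Match m)
pred-Match (skip m) = skip (pred-Match m)

Match-Valid : {f : Forest k s s′ xs xs′} → Match f w w′ → Valid s′ w′
Match-Valid root = []
Match-Valid {f = node _ _ _ r′ _ _ _} (down m) = r′ ∷ Match-Valid m
Match-Valid (skip m) = Match-Valid m

Match-~ : {f : Forest k s s′ xs xs′} → s ~⟨ k ⟩ s′ → Match f w w′ → final s w ~⟨ k ⟩ final s′ w′
Match-~ h root = h
Match-~ {f = node _ _ _ _ h _ _} _ (down m) = Match-~ h m
Match-~ h (skip m) = Match-~ h m

Match-head : {f : Forest k s s′ xs xs′} → Match f (i ∷ w) w′ → i ∈ˡ xs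
Match-head (down _) = here refl
Match-head (skip m) = there (Match-head m)

-- Root letters are pairwise distinct, so a nonempty prefix of a word is matched under the same root
-- letter; the mixed cases would repeat a letter.
Match-≼ : {f : Forest k s s′ xs xs′} → Match f u v → Match f x y → u ≼ x → v ≼ y
Match-≼ root     _        _        = _ , refl
Match-≼ (down _) root     (_ , ())
Match-≼ (skip _) root     (_ , ())
Match-≼ (down m) (down n) p        = ≼-∷ (Match-≼ m n (proj₂ (≼-∷⁻ p)))
Match-≼ {f = node i∉ _ _ _ _ _ _} (down m) (skip n) p with refl , _ ← ≼-∷⁻ p = contradiction (Match-head n) i∉
Match-≼ {f = node i∉ _ _ _ _ _ _} (skip m) (down n) p with refl , _ ← ≼-∷⁻ p = contradiction (Match-head m) i∉
Match-≼ (skip m) (skip n) p        = Match-≼ m n p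

-- The first letter is answered by a fresh one. Nothing is matched below it yet, so the rest of the
-- branch is grafted onto the empty forest, with `Follows` supplying the answers.
graft : ∀ w (f : Forest k s s′ xs xs′) → i ∉ xs → Valid s (i ∷ w) → Follows k (length (i ∷ w)) s s′ →
  ∃[ i′ ] ∃[ w′ ] Σ[ g ∈ Forest k s s′ (i ∷ xs) (i′ ∷ xs′) ]
    Match g (i ∷ w) (i′ ∷ w′) × (∀ {u v} → Match f u v → Match g u v)
graft {k} {s′ = s′} {xs′ = xs′} {i = i} w f i∉ (r ∷ v) F
  with t′ , r′ , h , F′ ← Follows-step F r
  with i′ , refl , i′∉ ← fresh t′ xs′
  with w | v
... | []    | _ =
  i′ , [] , node i∉ i′∉ r r′ h [] f , down root ,
    λ { root → root ; (down m) → skip (down m) ; (skip m) → skip (skip m) }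
... | j ∷ w | v
  with j′ , w′ , g , m , _ ← graft w [] (λ ()) v F′
  = i′ , j′ ∷ w′ , node i∉ i′∉ r r′ h g f , down m ,
    λ { root → root ; (down m) → skip (down m) ; (skip m) → skip (skip m) }

-- The outcome of one round in which `w` is chosen.
Extension : Forest (suc k) s s′ xs xs′ → Word → Set
Extension {k} {s} {s′} f w = ∃[ ys ] ∃[ ys′ ] Σ[ g ∈ Forest k s s′ ys ys′ ]
  (∃[ w′ ] Match g w w′) × (∀ {u v} → Match f u v → Match g u v)

mutual
  -- `w` is traced through the forest while its letters occur there. At the first new letter the
  -- states are still similar at `suc k`, and the remainder is grafted.
  extend : ∀ w (f : Forest (suc k) s s′ xs xs′) → s ~⟨ suc k ⟩ s′ → Valid s w → Extension f w
  extend []      f h v = _ , _ , pred f , (_ , root) , pred-Match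
  extend {xs = xs} (i ∷ w) f h v with mem? _≟_ i xs
  ... | no i∉ with i′ , w′ , g , m , ext ← graft w (pred f) i∉ v (~⇒Follows h) =
    _ , _ , g , (_ , m) , ext ∘ pred-Match
  ... | yes i∈ with g , i′ , w′ , m , ext ← descend f i∈ v = _ , _ , g , (_ , m) , ext

  descend : (f : Forest (suc k) s s′ xs xs′) → i ∈ˡ xs → Valid s (i ∷ w) →
    Σ[ g ∈ Forest k s s′ xs xs′ ] ∃[ i′ ] ∃[ w′ ]
      Match g (i ∷ w) (i′ ∷ w′) × (∀ {u v} → Match f u v → Match g u v)
  descend (node p p′ r r′ h g f) (here refl) (_ ∷ v)
    with _ , _ , g₁ , (w′ , m) , ext ← extend _ g h v
    = node p p′ r r′ (~-pred h) g₁ (pred f) , _ , w′ , down m ,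
      λ { root → root ; (down m) → down (ext m) ; (skip m) → skip (pred-Match m) }
  descend (node p p′ r r′ h g f) (there i∈) v
    with f₁ , i′ , w′ , m , ext ← descend f i∈ v
    = node p p′ r r′ (~-pred h) (pred g) f₁ , i′ , w′ , skip m ,
      λ { root → root ; (down m) → down (pred-Match m) ; (skip m) → skip (ext m) }

-- The game

qr : WMPL n k l → ℕ
qr (P _ _)   = 0
qr (_ ≤′ _)  = 0
qr (_ ∈′ _)  = 0
qr (¬′ φ)    = qr φ
qr (φ ∧′ ψ)  = qr φ ⊔ qr ψ
qr (∃′ φ)    = suc (qr φ)
qr (∃ᵖ φ)    = suc (suc (qr φ))

-- Only the endpoints of paths are matched: membership in an interval amounts to two prefix
-- comparisons, which `Match-≼` transfers.
record MatchPath (f : Forest q s s′ xs xs′) (W W′ : Pred Word 0ℓ) : Set where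
  constructor matchPath
  field
    {start end start′ end′} : Word
    match-start : Match f start start′
    match-end   : Match f end end′
    interval    : W ≐ Interval start end
    interval′   : W′ ≐ Interval start′ end′

flip-MatchPath : ∀ {f : Forest q s s′ xs xs′} {W W′} → MatchPath f W W′ → MatchPath (flip f) W′ W
flip-MatchPath (matchPath mr me I I′) = matchPath (flip-Match mr) (flip-Match me) I′ I

map-MatchPath : ∀ {f : Forest q s s′ xs xs′} {g : Forest k s s′ ys ys′} →
  (∀ {u v} → Match f u v → Match g u v) → ∀ {W W′} → MatchPath f W W′ → MatchPath g W W′
map-MatchPath ext (matchPath mr me I I′) = matchPath (ext mr) (ext me) I I′

-- One implication suffices, because the relation between the two trees is symmetric: negation is
-- handled by flipping the position.
transfer : (φ : WMPL 1 k l) → qr φ ≤ q → s ~⟨ q ⟩ s′ → (f : Forest q s s′ xs xs′) →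
  ∀ {ρ ρ′ η η′} → (∀ x → Match f (ρ x) (ρ′ x)) → (∀ X → MatchPath f (η X) (η′ X)) →
  Holds (𝒯 s) ρ η φ → Holds (𝒯 s′) ρ′ η′ φ
transfer (P a x) _ h f M N (lift p) = lift (subst (a ∈ˢ_) (label-cong (Match-~ h (M x))) p)
transfer (x ≤′ y) _ h f M N (lift p) = lift (Match-≼ (M x) (M y) p)
transfer (x ∈′ X) _ h f M N (lift p) with matchPath mr me (to , _) (_ , from′) ← N X =
  lift (from′ (Match-≼ mr (M x) (proj₁ (to p)) , Match-≼ (M x) me (proj₂ (to p))))
transfer (¬′ φ) le h f M N p p′ =
  p (transfer φ le (~-sym h) (flip f) (λ x → flip-Match (M x)) (λ X → flip-MatchPath (N X)) p′)
transfer (φ ∧′ ψ) le h f M N (p , p′) =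
  transfer φ (m⊔n≤o⇒m≤o (qr φ) (qr ψ) le) h f M N p , transfer ψ (m⊔n≤o⇒n≤o (qr φ) (qr ψ) le) h f M N p′
transfer (∃′ φ) (s≤s le) h f M N (w , w∈ , p)
  with _ , _ , g , (w′ , m) , ext ← extend w f h w∈
  = w′ , Match-Valid m ,
    transfer φ le (~-pred h) g (λ { zero → m ; (suc x) → ext (M x) }) (λ X → map-MatchPath ext (N X)) p
transfer (∃ᵖ φ) (s≤s (s≤s le)) h f M N (W , (path , fin) , p)
  with r , e , r∈ , e∈ , r≼e , I ← finitePath⇒Interval path fin
  with _ , _ , g₁ , (r′ , m₁) , ext₁ ← extend r f h r∈
  -- The second endpoint is answered in an extension of `g₁`, so that both endpoints are matched in
  -- one forest and `r′ ≼ e′` follows.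
  with _ , _ , g₂ , (e′ , m₂) , ext₂ ← extend e g₁ (~-pred h) e∈
  = Interval r′ e′ , (Interval-path (λ w≼ → Valid-≼ w≼ (Match-Valid m₂)) r′≼e′ , Interval-finite r′≼e′) ,
    transfer φ le (~-pred (~-pred h)) g₂ (λ x → ext₂ (ext₁ (M x)))
      (λ { zero → matchPath (ext₂ m₁) m₂ I ((λ z → z) , (λ z → z))
         ; (suc X) → map-MatchPath (ext₂ ∘ ext₁) (N X) }) p
  where
  r′≼e′ = Match-≼ (ext₂ m₁) m₂ r≼e

-- The sentence

AF : OSAFGMCSentence 1
AF = record
  { sentence = record
    -- Fewer than one child violates `var 0`, that is, all children satisfy it.
    { formula  = fix μ 0 (atom zero ∨′ □< 1 (var 0))
    ; oneStep  = fix μ 0 (base (atom zero ∨′ □< 1 (var (inj₂ refl))))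
    ; positive = λ { here → tt , λ _ → refl ; (fix _ (∨ˡ ())) ; (fix _ (∨ʳ (box ()))) }
    }
  ; alternationFree = λ { here (∨ˡ ()) ; here (∨ʳ (box ())) ; (fix _ (∨ˡ ())) ; (fix _ (∨ʳ (box ()))) }
  }

_⊨AF : KripkeTree 1 → Set₁
𝒦 ⊨AF = Logic._⊨_ osafgmc 𝒦 AF

-- Any prefixed point `W` contains every node, by well-founded induction along the lexicographic
-- order. A `loop` step need not descend in it, but leads to level 0, where the label already puts
-- the node in `W`.
rank⊨AF : ∀ a b → 𝒯 (rank a b) ⊨AF
rank⊨AF a b W W⊆ closed = level a b [] refl
  where
  Good : State → Set
  Good t = ∀ {w} → Valid (rank a b) w → final (rank a b) w ≡ t → w ∈ W
  zero-level : ∀ d → Good (rank 0 d)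
  zero-level d v eq = closed (inj₁ (lift (v , subst (λ t → zero ∈ˢ label t) (sym eq) Vec.here)))
  step : (∀ {t} → s ⇒ t → Good t) → Good s
  step good {w} v refl = closed (inj₂ (v , λ (f , _ , f∈) →
    let (f∈T , i , eq) , f∉ = f∈ zero in
    f∉ (lift (good (Valid-∷ʳ⁻ w (subst (Valid _) eq f∈T)) f∈T (trans (cong (final _) eq) (final-∷ʳ _ w))))))
  level : ∀ c d → Good (rank c d)
  level = <-rec (λ c → ∀ d → Good (rank c d)) λ c lower-level → <-rec (λ d → Good (rank c d)) λ d lower-rank → step λ
    { (drop h) → lower-level h _ ; (stay h) → lower-rank h ; loop → zero-level _ }

Ranked : Pred Word 0ℓ
Ranked w = Valid inf w × ∃[ a ] ∃[ b ] final inf w ≡ rank a b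

-- `Ranked` is a prefixed point missing the root, so the least fixpoint misses it too: a node in
-- state `inf` is unlabelled and has a child in state `inf`, outside `Ranked`.
Ranked-closed : ⟦ 𝒯 inf ⟧ (atom zero ∨′ □< 1 (var 0)) ((λ _ _ → ⊥) [ 0 ↦ Ranked ]) ⊆ Ranked
Ranked-closed {w} sat with final inf w in eq
Ranked-closed     (inj₁ (lift (v , ())))     | inf
Ranked-closed {w} (inj₂ (v , less))          | inf
  with i , eqᵢ , _ ← letter inf 0
  = ⊥-elim (less ((λ _ → w ∷ʳ i) , (λ { {zero} {zero} _ → refl }) , λ _ →
      (Valid-∷ʳ v (subst (_⇒ decode i) (sym eq) any) , i , refl) ,
      λ (lift (_ , _ , _ , eq′)) → inf≢rank (trans (sym (trans (final-∷ʳ inf w) eqᵢ)) eq′)))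
  where
  inf≢rank : ¬ inf ≡ rank a b
  inf≢rank ()
Ranked-closed     (inj₁ (lift (v , _)))      | rank a b = v , a , b , refl
Ranked-closed     (inj₂ (v , _))             | rank a b = v , a , b , refl

inf⊭AF : ¬ 𝒯 inf ⊨AF
inf⊭AF p with () ← proj₂ (proj₂ (proj₂ (p Ranked proj₁ Ranked-closed)))

corollary5 : osafgmc ≰ᴸ wmpl
corollary5 L≤L′ with ψ , equiv ← L≤L′ 1 AF =
  inf⊭AF (from (equiv (𝒯 inf))
    -- Level `suc (qr ψ)` is the lowest one similar to `inf` for `qr ψ` rounds; the second component
    -- 0 is arbitrary. As `ψ` has no free variables, the game starts from the empty forest.
    (transfer ψ ≤-refl (both (rank (n<1+n _)) inf) [] (λ ()) (λ ())
      (to (equiv (𝒯 (rank (suc (qr ψ)) 0))) (rank⊨AF (suc (qr ψ)) 0))))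
  where open Equivalence
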